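{- There exist absolute constants $c,c'>0$ and $n_0$ such that for every $n\ge n_0$ there is a function $f:\{0,1\}^{n^2}\to\{0,1\}$ with $bs(f)\le bs^*(f)\le c\,n$ and $C(f)\ge c'\,n^2$.
   Context: For $x\in\{0,1\}^N$ and $B\subseteq[N]$, $x\oplus B$ is $x$ with the bits in $B$ flipped; a block of $f$ at $x$ is $B$ with $f(x\oplus B)\ne f(x)$. $bs_x(f)$ is the maximum number of pairwise disjoint blocks at $x$; $bs^*_x(f)$ is the maximum of $\sum_B\lambda(B)$ over nonnegative $\lambda$ on blocks at $x$ with $\sum_{B\ni i}\lambda(B)\le1$ for every $i$; $C_x(f)$ is the minimum size of a set $S\subseteq[N]$ meeting every block at $x$. For $m\in\{bs,bs^*,C\}$, $m(f)=\max_x m_x(f)$. -}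

module Defs where

open import Data.Nat as ℕ using (ℕ; zero; suc)
open import Data.Bool using (Bool; true; false; _xor_; if_then_else_)
import Data.Bool.Properties as BoolP
open import Data.Vec using (Vec; []; _∷_; zipWith)
open import Data.List using (List; []; _∷_; map; _++_; foldr; length)
open import Data.List.Relation.Unary.All using (All)
open import Data.List.Relation.Unary.AllPairs using (AllPairs)
open import Data.Fin using (Fin)
open import Data.Fin.Subset using (Subset; _∈_; _∩_; ∣_∣; Empty; Nonempty)
open import Data.Integer using (+_)
open import Data.Rational using (ℚ; 0ℚ; 1ℚ; _+_; _/_; _≤_)
open import Relation.Binary.PropositionalEquality using (_≡_; _≢_)
open import Relation.Nullary using (Dec; does; ¬_; ¬?)
open import Data.Product using (Σ; _×_)

Input : ℕ → Set
Input N = Vec Bool N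

BoolFun : ℕ → Set
BoolFun N = Input N → Bool

_⊕_ : ∀ {N} → Input N → Subset N → Input N
x ⊕ B = zipWith _xor_ x B

IsBlock : ∀ {N} → BoolFun N → Input N → Subset N → Set
IsBlock f x B = f (x ⊕ B) ≢ f x

isBlock? : ∀ {N} (f : BoolFun N) (x : Input N) (B : Subset N) → Dec (IsBlock f x B)
isBlock? f x B = ¬? (f (x ⊕ B) BoolP.≟ f x)

allSubsets : (N : ℕ) → List (Subset N)
allSubsets zero = [] ∷ []
allSubsets (suc N) = map (true ∷_) (allSubsets N) ++ map (false ∷_) (allSubsets N)

sumℚ : ∀ {A : Set} → (A → ℚ) → List A → ℚ
sumℚ g = foldr (λ a s → g a + s) 0ℚ

toℚ : ℕ → ℚ
toℚ k = (+ k) / 1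

blockSum : ∀ {N} (f : BoolFun N) (x : Input N) (P : Subset N → Bool) (λ′ : Subset N → ℚ) → ℚ
blockSum {N} f x P λ′ =
  sumℚ (λ B → if does (isBlock? f x B) then (if P B then λ′ B else 0ℚ) else 0ℚ) (allSubsets N)

_∈ᵇ_ : ∀ {N} → Fin N → Subset N → Bool
_∈ᵇ_ {suc N} Fin.zero (b ∷ B) = b
_∈ᵇ_ {suc N} (Fin.suc i) (b ∷ B) = i ∈ᵇ B

FracPacking : ∀ {N} → BoolFun N → Input N → (Subset N → ℚ) → Set
FracPacking {N} f x λ′ =
  (∀ B → 0ℚ ≤ λ′ B) × (∀ (i : Fin N) → blockSum f x (λ B → i ∈ᵇ B) λ′ ≤ 1ℚ)

packValue : ∀ {N} → BoolFun N → Input N → (Subset N → ℚ) → ℚ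
packValue f x λ′ = blockSum f x (λ _ → true) λ′

Disjoint : ∀ {N} → Subset N → Subset N → Set
Disjoint A B = Empty (A ∩ B)

BsAtMost : ∀ {N} → BoolFun N → ℚ → Set
BsAtMost f r = ∀ x (Bs : List _) → All (IsBlock f x) Bs → AllPairs Disjoint Bs →
  toℚ (length Bs) ≤ r

-- bs*(f) ≤ r : every feasible fractional block packing at any x has value ≤ r
-- (the LP optimum is attained at a rational point, so rational λ suffice)
BsStarAtMost : ∀ {N} → BoolFun N → ℚ → Set
BsStarAtMost f r = ∀ x λ′ → FracPacking f x λ′ → packValue f x λ′ ≤ r

HittingSet : ∀ {N} → BoolFun N → Input N → Subset N → Set
HittingSet f x S = ∀ B → IsBlock f x B → Nonempty (S ∩ B)

CAtLeast : ∀ {N} → BoolFun N → ℚ → Set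
CAtLeast {N} f r = Σ (Input N) λ x → ∀ S → HittingSet f x S → r ≤ toℚ ∣ S ∣

{-# OPTIONS --safe #-}
module Submission where

-- Let g : {0,1}ⁿ → {0,1} be the indicator of the nonzero words of a linear code
-- of dimension and minimum distance m = ⌊n/5⌋ (Gilbert–Varshamov), and let f be
-- the disjunction of n copies of g on disjoint inputs.  At a 0-input of g at most
-- one block has fewer than m/2 elements, so the blocks have a fractional hitting
-- set of weight O(n/m) = O(1): a single coordinate for the short block and weight
-- 2/m everywhere for the others.  Hence bs* ≤ O(n) at 0-inputs of f, while at a
-- 1-input every block meets any fixed row on which g is true, giving bs* ≤ n.
-- On the other hand fewer than m coordinates of a row never certify g(0) = 0,
-- since by pigeonhole some nonzero codeword vanishes on them; so C₀(f) ≥ n m.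

open import Defs
open import Algebra.Bundles using (CommutativeRing)
import Algebra.Properties.CommutativeSemigroup as CommutativeSemigroupProperties
open import Data.Bool using (Bool; true; false; _xor_; _∨_; if_then_else_)
import Data.Bool.Properties as Bool
open import Data.Fin using (Fin; zero; suc; combine; _↑ˡ_; _↑ʳ_; splitAt)
import Data.Fin.Properties as Fin
open import Data.Fin.Subset using (Subset; ⊥; ∣_∣; _∩_; Empty; Nonempty)
open import Data.Fin.Subset.Properties using (anySubset?; ∉⊥; ∩-zeroʳ; ∣⊥∣≡0)
import Data.Integer as ℤ
import Data.Integer.Properties as ℤ
open import Data.List using ([]; _∷_; length)
open import Data.List.Relation.Unary.All using (All; []; _∷_)
import Data.List.Relation.Unary.All as All
open import Data.List.Relation.Unary.AllPairs using (AllPairs; []; _∷_)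
open import Data.Nat using (ℕ; zero; suc; _+_; _*_; _^_; _≤_; _<_; z≤n; s≤s; s<s⁻¹; z<s; _<?_)
import Data.Nat as ℕ
open import Data.Nat.DivMod using (_/_; _%_; m≡m%n+[m/n]*n; m%n<n; m/n*n≤m; m≥n⇒m/n>0)
open import Data.Nat.Properties
open import Data.Nat.Tactic.RingSolver using (solve-∀)
open import Data.Product using (Σ; ∃; ∃₂; _×_; _,_; proj₁; proj₂)
open import Data.Rational using (ℚ; 0ℚ; 1ℚ; Positive)
import Data.Rational as ℚ
import Data.Rational.Properties as ℚ
import Data.Rational.Unnormalised as ℚᵘ
import Data.Rational.Unnormalised.Properties as ℚᵘ
open import Data.Sum using (_⊎_; inj₁; inj₂)
open import Data.Vec using (Vec; []; _∷_; _++_; take; drop; replicate; sum; zipWith)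
open import Data.Vec.Base using (here; there)
import Data.Vec as Vec
import Data.Vec.Properties as Vec
open import Function using (_∘_)
open import Relation.Binary.PropositionalEquality
open import Relation.Nullary using (Dec; yes; no; does; ¬?; contradiction; decidable-stable; _×-dec_)
open import Relation.Nullary.Decidable using (dec-true; dec-false)
open CommutativeSemigroupProperties +-commutativeSemigroup
  using () renaming (interchange to +-interchange; x∙yz≈y∙xz to +-swap)

-- The group of bit vectors

⊕-comm : ∀ {n} (x y : Vec Bool n) → x ⊕ y ≡ y ⊕ x
⊕-comm = Vec.zipWith-comm Bool.xor-comm

⊕-assoc : ∀ {n} (x y z : Vec Bool n) → (x ⊕ y) ⊕ z ≡ x ⊕ (y ⊕ z)
⊕-assoc = Vec.zipWith-assoc Bool.xor-assoc

⊕-identityˡ : ∀ {n} (x : Vec Bool n) → ⊥ ⊕ x ≡ x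
⊕-identityˡ = Vec.zipWith-identityˡ Bool.xor-identityˡ

⊕-identityʳ : ∀ {n} (x : Vec Bool n) → x ⊕ ⊥ ≡ x
⊕-identityʳ x = trans (⊕-comm x ⊥) (⊕-identityˡ x)

⊕-self : ∀ {n} (x : Vec Bool n) → x ⊕ x ≡ ⊥
⊕-self []       = refl
⊕-self (b ∷ x) = cong₂ _∷_ (Bool.xor-same b) (⊕-self x)

⊕-cancel : ∀ {n} (x y : Vec Bool n) → x ⊕ (x ⊕ y) ≡ y
⊕-cancel x y = begin
  x ⊕ (x ⊕ y)  ≡⟨ ⊕-assoc x x y ⟨
  (x ⊕ x) ⊕ y  ≡⟨ cong (_⊕ y) (⊕-self x) ⟩
  ⊥ ⊕ y        ≡⟨ ⊕-identityˡ y ⟩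
  y            ∎
  where open ≡-Reasoning

⊕-injectiveʳ : ∀ {n} (x : Vec Bool n) {y z} → x ⊕ y ≡ x ⊕ z → y ≡ z
⊕-injectiveʳ x {y} {z} eq =
  trans (sym (⊕-cancel x y)) (trans (cong (x ⊕_) eq) (⊕-cancel x z))

⊕-injectiveˡ : ∀ {n} (x : Vec Bool n) {y z} → y ⊕ x ≡ z ⊕ x → y ≡ z
⊕-injectiveˡ x {y} {z} eq =
  ⊕-injectiveʳ x (trans (⊕-comm x y) (trans eq (⊕-comm z x)))

⊕-interchange : ∀ {n} (x y z w : Vec Bool n) → (x ⊕ y) ⊕ (z ⊕ w) ≡ (x ⊕ z) ⊕ (y ⊕ w)
⊕-interchange []      []      []      []      = refl
⊕-interchange (a ∷ x) (b ∷ y) (c ∷ z) (d ∷ w) =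
  cong₂ _∷_ (interchange a b c d) (⊕-interchange x y z w)
  where
  open CommutativeSemigroupProperties (CommutativeRing.+-commutativeSemigroup Bool.xor-∧-commutativeRing)
    using (interchange)

⊕-translate : ∀ {n} (x y z : Vec Bool n) → (x ⊕ y) ⊕ (x ⊕ z) ≡ y ⊕ z
⊕-translate x y z = begin
  (x ⊕ y) ⊕ (x ⊕ z)  ≡⟨ ⊕-interchange x y x z ⟩
  (x ⊕ x) ⊕ (y ⊕ z)  ≡⟨ cong (_⊕ (y ⊕ z)) (⊕-self x) ⟩
  ⊥ ⊕ (y ⊕ z)        ≡⟨ ⊕-identityˡ (y ⊕ z) ⟩
  y ⊕ z              ∎
  where open ≡-Reasoning

⊕≡⊥⇒≡ : ∀ {n} (x y : Vec Bool n) → x ⊕ y ≡ ⊥ → x ≡ y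
⊕≡⊥⇒≡ x y eq = ⊕-injectiveˡ y (trans eq (sym (⊕-self y)))

∣⊕∣-≤ : ∀ {n} (x y : Vec Bool n) → ∣ x ⊕ y ∣ ≤ ∣ x ∣ + ∣ y ∣
∣⊕∣-≤ []          []          = z≤n
∣⊕∣-≤ (false ∷ x) (false ∷ y) = ∣⊕∣-≤ x y
∣⊕∣-≤ (true  ∷ x) (false ∷ y) = s≤s (∣⊕∣-≤ x y)
∣⊕∣-≤ (false ∷ x) (true  ∷ y) rewrite +-suc ∣ x ∣ ∣ y ∣ = s≤s (∣⊕∣-≤ x y)
∣⊕∣-≤ (true  ∷ x) (true  ∷ y) rewrite +-suc ∣ x ∣ ∣ y ∣ = m≤n⇒m≤1+n (m≤n⇒m≤1+n (∣⊕∣-≤ x y))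

-- Counting

toIndex : ∀ {k} → Vec Bool k → Fin (2 ^ k)
toIndex []          = zero
toIndex (false ∷ x) = combine {2} zero (toIndex x)
toIndex (true  ∷ x) = combine {2} (suc zero) (toIndex x)

toIndex-surjective : ∀ k (i : Fin (2 ^ k)) → ∃ λ (x : Vec Bool k) → toIndex x ≡ i
toIndex-surjective zero    zero = [] , refl
toIndex-surjective (suc k) i with Fin.combine-surjective {2} {2 ^ k} i
... | zero     , r , refl = let x , eq = toIndex-surjective k r in false ∷ x , cong (combine {2} zero) eq
... | suc zero , r , refl = let x , eq = toIndex-surjective k r in true ∷ x , cong (combine {2} (suc zero)) eq

toIndex-injective : ∀ {k} (x y : Vec Bool k) → toIndex x ≡ toIndex y → x ≡ y
toIndex-injective []          []          _  = refl
toIndex-injective (false ∷ x) (false ∷ y) eq =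
  cong (false ∷_) (toIndex-injective x y (Fin.combine-injectiveʳ {2} zero (toIndex x) zero (toIndex y) eq))
toIndex-injective (true ∷ x)  (true ∷ y)  eq =
  cong (true ∷_) (toIndex-injective x y (Fin.combine-injectiveʳ {2} (suc zero) (toIndex x) (suc zero) (toIndex y) eq))
toIndex-injective (false ∷ x) (true ∷ y)  eq
  with () ← Fin.combine-injectiveˡ {2} zero (toIndex x) (suc zero) (toIndex y) eq
toIndex-injective (true ∷ x)  (false ∷ y) eq
  with () ← Fin.combine-injectiveˡ {2} (suc zero) (toIndex x) zero (toIndex y) eq

-- Pigeonhole on indices: decoding through `toIndex-surjective` is a section of `toIndex`, so
-- distinct indices decode to distinct vectors.
collision : ∀ {k m} → m < 2 ^ k → (φ : Vec Bool k → Fin m) → ∃₂ λ x y → x ≢ y × φ x ≡ φ y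
collision {k} m<2^k φ
  with i , j , i<j , eq ← Fin.pigeonhole m<2^k (φ ∘ proj₁ ∘ toIndex-surjective k)
  with x , refl ← toIndex-surjective k i | y , refl ← toIndex-surjective k j
  = x , y , (λ { refl → <-irrefl refl i<j }) , eq

-- The number of bit vectors of length n and weight less than d.
ballSize : ℕ → ℕ → ℕ
ballSize n       zero    = 0
ballSize zero    (suc d) = 1
ballSize (suc n) (suc d) = ballSize n (suc d) + ballSize n d

-- Follows the Pascal recursion of `ballSize`: words beginning with `false` take the first summand,
-- and those beginning with `true`, whose tail has one unit of weight less to spend, take the
-- second.
ballIndex : ∀ {n d} (x : Vec Bool n) → ∣ x ∣ < d → Fin (ballSize n d)
ballIndex {zero}  {suc d} []          _ = zero
ballIndex {suc n} {suc d} (false ∷ x) p = ballIndex x p ↑ˡ ballSize n d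
ballIndex {suc n} {suc d} (true  ∷ x) p = ballSize n (suc d) ↑ʳ ballIndex x (s<s⁻¹ p)

↑ˡ≢↑ʳ : ∀ {m n} (i : Fin m) (j : Fin n) → i ↑ˡ n ≢ m ↑ʳ j
↑ˡ≢↑ʳ {m} {n} i j eq
  with () ← trans (sym (Fin.splitAt-↑ˡ m i n)) (trans (cong (splitAt m) eq) (Fin.splitAt-↑ʳ m n j))

ballIndex-injective : ∀ {n d} (x y : Vec Bool n) (p : ∣ x ∣ < d) (q : ∣ y ∣ < d) →
  ballIndex x p ≡ ballIndex y q → x ≡ y
ballIndex-injective {zero}  {suc d} [] [] p q eq = refl
ballIndex-injective {suc n} {suc d} (false ∷ x) (false ∷ y) p q eq =
  cong (false ∷_) (ballIndex-injective x y p q (Fin.↑ˡ-injective _ _ _ eq))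
ballIndex-injective {suc n} {suc d} (true ∷ x) (true ∷ y) p q eq =
  cong (true ∷_) (ballIndex-injective x y _ _ (Fin.↑ʳ-injective (ballSize n (suc d)) _ _ eq))
ballIndex-injective {suc n} {suc d} (false ∷ x) (true ∷ y) p q eq = contradiction eq (↑ˡ≢↑ʳ _ _)
ballIndex-injective {suc n} {suc d} (true ∷ x) (false ∷ y) p q eq = contradiction (sym eq) (↑ˡ≢↑ʳ _ _)

-- Chernoff's bound ∑_{∣e∣<d} 1 ≤ ∑_e z^(∣e∣-d) = (1 + z)ⁿ z⁻ᵈ at z = 1/2.
ballSize-bound : ∀ n d → ballSize n d * 2 ^ n ≤ 3 ^ n * 2 ^ d
ballSize-bound n       zero    = z≤n
ballSize-bound zero    (suc d) = ≤-trans (m^n>0 2 (suc d)) (≤-reflexive (sym (*-identityˡ _)))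
ballSize-bound (suc n) (suc d) = begin
  (ballSize n (suc d) + ballSize n d) * (2 * 2 ^ n)
    ≡⟨ expand (ballSize n (suc d)) (ballSize n d) (2 ^ n) ⟩
  2 * (ballSize n (suc d) * 2 ^ n) + 2 * (ballSize n d * 2 ^ n)
    ≤⟨ +-mono-≤ (*-monoʳ-≤ 2 (ballSize-bound n (suc d))) (*-monoʳ-≤ 2 (ballSize-bound n d)) ⟩
  2 * (3 ^ n * (2 * 2 ^ d)) + 2 * (3 ^ n * 2 ^ d)
    ≡⟨ collect (3 ^ n) (2 ^ d) ⟩
  3 * 3 ^ n * (2 * 2 ^ d) ∎
  where
  open ≤-Reasoning
  expand : ∀ a b t → (a + b) * (2 * t) ≡ 2 * (a * t) + 2 * (b * t)
  expand = solve-∀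
  collect : ∀ u v → 2 * (u * (2 * v)) + 2 * (u * v) ≡ 3 * u * (2 * v)
  collect = solve-∀

-- Linear codes

record LinearCode (k n d : ℕ) : Set where
  field
    encode   : Vec Bool k → Vec Bool n
    encode-⊕ : ∀ a b → encode (a ⊕ b) ≡ encode a ⊕ encode b
    distance : ∀ a → a ≢ ⊥ → d ≤ ∣ encode a ∣

-- Covering argument: if every vector were closer than `d` to some `φ a`, then `a` together with the
-- difference would determine the vector, and 2ⁿ vectors would inject into fewer pairs.
farPoint : ∀ {k n} d → 2 ^ k * ballSize n d < 2 ^ n → (φ : Vec Bool k → Vec Bool n) →
  ∃ λ v → ∀ a → d ≤ ∣ v ⊕ φ a ∣
farPoint {k} {n} d small φ
  with anySubset? (λ v → ¬? (anySubset? (λ a → ∣ v ⊕ φ a ∣ <? d)))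
... | yes (v , far) = v , λ a → ≮⇒≥ (λ near → far (a , near))
... | no  noFar     =
  let v , w , v≢w , eq   = collision small index
      sameCentre , same  = Fin.combine-injective (toIndex (centre v)) _ (toIndex (centre w)) _ eq
      v⊕≡w⊕              = ballIndex-injective (v ⊕ φ (centre v)) (w ⊕ φ (centre w)) (close v) (close w) same
      c≡c′               = toIndex-injective (centre v) (centre w) sameCentre
  in contradiction (⊕-injectiveˡ (φ (centre v)) (trans v⊕≡w⊕ (cong (λ c → w ⊕ φ c) (sym c≡c′)))) v≢w
  where
  covered : ∀ v → ∃ λ a → ∣ v ⊕ φ a ∣ < d
  -- `noFar` yields only a double negation; the search over messages is decidable, so a witness can
  -- be extracted.
  covered v = decidable-stable (anySubset? (λ a → ∣ v ⊕ φ a ∣ <? d)) (λ far → noFar (v , far))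
  centre : Vec Bool n → Vec Bool k
  centre v = proj₁ (covered v)
  close : ∀ v → ∣ v ⊕ φ (centre v) ∣ < d
  close v = proj₂ (covered v)
  index : Vec Bool n → Fin (2 ^ k * ballSize n d)
  index v = combine (toIndex (centre v)) (ballIndex (v ⊕ φ (centre v)) (close v))

-- Greedy choice of generators. The new generator is far from every earlier codeword, so each word
-- that uses it is heavy; the remaining words are earlier codewords. The counting hypothesis passes
-- to smaller dimensions.
gilbertVarshamov : ∀ k n d → 2 ^ k * ballSize n d < 2 ^ n → LinearCode k n d
gilbertVarshamov zero n d _ = record
  { encode   = λ _ → ⊥
  ; encode-⊕ = λ _ _ → sym (⊕-self ⊥)
  ; distance = λ { [] []≢⊥ → contradiction refl []≢⊥ }
  }
gilbertVarshamov (suc k) n d small = record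
  { encode = encode′ ; encode-⊕ = encode′-⊕ ; distance = distance′ }
  where
  small′ : 2 ^ k * ballSize n d < 2 ^ n
  small′ = ≤-<-trans (*-monoˡ-≤ (ballSize n d) (m≤m+n (2 ^ k) _)) small
  open LinearCode (gilbertVarshamov k n d small′)
  new : ∃ λ v → ∀ a → d ≤ ∣ v ⊕ encode a ∣
  new = farPoint d small′ encode
  v = proj₁ new
  multiple : Bool → Vec Bool n
  multiple b = if b then v else ⊥
  multiple-xor : ∀ b c → multiple (b xor c) ≡ multiple b ⊕ multiple c
  multiple-xor false c     = sym (⊕-identityˡ _)
  multiple-xor true  false = sym (⊕-identityʳ v)
  multiple-xor true  true  = sym (⊕-self v)
  encode′ : Vec Bool (suc k) → Vec Bool n
  encode′ (b ∷ a) = multiple b ⊕ encode a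
  encode′-⊕ : ∀ a b → encode′ (a ⊕ b) ≡ encode′ a ⊕ encode′ b
  encode′-⊕ (b ∷ x) (c ∷ y) = trans
    (cong₂ _⊕_ (multiple-xor b c) (encode-⊕ x y))
    (⊕-interchange (multiple b) (multiple c) (encode x) (encode y))
  distance′ : ∀ a → a ≢ ⊥ → d ≤ ∣ encode′ a ∣
  distance′ (true  ∷ a) _    = proj₂ new a
  distance′ (false ∷ a) a≢⊥ rewrite ⊕-identityˡ (encode a) = distance a (a≢⊥ ∘ cong (false ∷_))

-- The factor 5 comes from 4 · 3⁵ = 972 < 1024 = 4⁵.
goodCode : ∀ m n .{{_ : ℕ.NonZero m}} → 5 * m ≤ n → LinearCode m n m
goodCode m n 5m≤n = gilbertVarshamov m n m
  -- The extra factor `2 ^ n` brings in `ballSize-bound` and turns the target into `4 ^ n`; both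
  -- sides are then split along n = 5m + r.
  (*-cancelʳ-< _ _ _ (begin-strict
    2 ^ m * ballSize n m * 2 ^ n              ≡⟨ *-assoc (2 ^ m) _ _ ⟩
    2 ^ m * (ballSize n m * 2 ^ n)            ≤⟨ *-monoʳ-≤ (2 ^ m) (ballSize-bound n m) ⟩
    2 ^ m * (3 ^ n * 2 ^ m)                   ≡⟨ cong (λ t → 2 ^ m * (3 ^ t * 2 ^ m)) n≡ ⟩
    2 ^ m * (3 ^ (5 * m + r) * 2 ^ m)         ≡⟨ cong (λ t → 2 ^ m * (t * 2 ^ m)) (split 3) ⟩
    2 ^ m * (243 ^ m * 3 ^ r * 2 ^ m)         ≡⟨ regroup (2 ^ m) (243 ^ m) (3 ^ r) ⟩
    2 ^ m * 2 ^ m * 243 ^ m * 3 ^ r           ≡⟨ cong (λ t → t * 243 ^ m * 3 ^ r) (power-* 2 2 m) ⟩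
    4 ^ m * 243 ^ m * 3 ^ r                   ≡⟨ cong (_* 3 ^ r) (power-* 4 243 m) ⟩
    972 ^ m * 3 ^ r                           ≤⟨ *-monoʳ-≤ (972 ^ m) (^-monoˡ-≤ r (n≤1+n 3)) ⟩
    -- The strict step: 973 + 51 = 1024, and `m` is nonzero.
    972 ^ m * 4 ^ r                           <⟨ *-monoˡ-< (4 ^ r) {{m^n≢0 4 r}} (^-monoˡ-< m (m≤m+n 973 51)) ⟩
    1024 ^ m * 4 ^ r                          ≡⟨ split 4 ⟨
    4 ^ (5 * m + r)                           ≡⟨ cong (4 ^_) n≡ ⟨
    4 ^ n                                     ≡⟨ power-* 2 2 n ⟨
    2 ^ n * 2 ^ n                             ∎))
  where
  open ≤-Reasoning
  r = n ℕ.∸ 5 * m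
  n≡ : n ≡ 5 * m + r
  n≡ = sym (m+[n∸m]≡n 5m≤n)
  split : ∀ b → b ^ (5 * m + r) ≡ (b ^ 5) ^ m * b ^ r
  split b = trans (^-distribˡ-+-* b (5 * m) r) (cong (_* b ^ r) (sym (^-*-assoc b 5 m)))
  regroup : ∀ a b c → a * (b * c * a) ≡ a * a * b * c
  regroup = solve-∀
  power-* : ∀ a b k → a ^ k * b ^ k ≡ (a * b) ^ k
  power-* a b zero    = refl
  power-* a b (suc k) = trans (shuffle a b (a ^ k) (b ^ k)) (cong (a * b *_) (power-* a b k))
    where
    shuffle : ∀ a b s t → a * s * (b * t) ≡ a * b * (s * t)
    shuffle = solve-∀

-- Weighted covers

weight : ∀ {n} → Vec ℕ n → Subset n → ℕ
weight []      []      = 0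
weight (a ∷ w) (b ∷ B) = (if b then a else 0) + weight w B

-- Integer weights of total at most W giving each block weight at least D:
-- a dual solution of value W / D for the packing program.
Cover : ∀ {n} → BoolFun n → Input n → ℕ → ℕ → Set
Cover {n} f x D W = Σ (Vec ℕ n) λ w → sum w ≤ W × ∀ B → IsBlock f x B → D ≤ weight w B

weight-++ : ∀ {m n} (w : Vec ℕ m) (v : Vec ℕ n) (B : Subset (m + n)) →
  weight (w ++ v) B ≡ weight w (take m B) + weight v (drop m B)
weight-++ []      v B       = refl
weight-++ (a ∷ w) v (b ∷ B) = trans
  (cong (_ +_) (weight-++ w v B)) (sym (+-assoc (if b then a else 0) _ _))

weight-zipWith-+ : ∀ {n} (w v : Vec ℕ n) B → weight (zipWith _+_ w v) B ≡ weight w B + weight v B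
weight-zipWith-+ []      []      []          = refl
weight-zipWith-+ (a ∷ w) (c ∷ v) (false ∷ B) = weight-zipWith-+ w v B
weight-zipWith-+ (a ∷ w) (c ∷ v) (true ∷ B)  =
  trans (cong (a + c +_) (weight-zipWith-+ w v B)) (+-interchange a c (weight w B) (weight v B))

sum-zipWith-+ : ∀ {n} (w v : Vec ℕ n) → sum (zipWith _+_ w v) ≡ sum w + sum v
sum-zipWith-+ []      []      = refl
sum-zipWith-+ (a ∷ w) (c ∷ v) =
  trans (cong (a + c +_) (sum-zipWith-+ w v)) (+-interchange a c (sum w) (sum v))

weight-replicate : ∀ {n} c (B : Subset n) → weight (replicate n c) B ≡ c * ∣ B ∣
weight-replicate c []          = sym (*-zeroʳ c)
weight-replicate c (false ∷ B) = weight-replicate c B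
weight-replicate c (true ∷ B)  = trans (cong (_+_ c) (weight-replicate c B)) (sym (*-suc c ∣ B ∣))

sum-replicate : ∀ n c → sum (replicate n c) ≡ n * c
sum-replicate zero    c = refl
sum-replicate (suc n) c = cong (c +_) (sum-replicate n c)

sum-zeros : ∀ n → sum (replicate n 0) ≡ 0
sum-zeros n = trans (sum-replicate n 0) (*-zeroʳ n)

-- All the weight sits on the first element of `B`.
pointWeight : ∀ {n} D (B : Subset n) → B ≢ ⊥ →
  Σ (Vec ℕ n) λ w → sum w ≡ D × weight w B ≡ D
pointWeight D []          B≢⊥ = contradiction refl B≢⊥
pointWeight {suc n} D (true ∷ B)  _ = D ∷ replicate n 0 ,
  trans (cong (D +_) (sum-zeros n)) (+-identityʳ D) ,
  trans (cong (D +_) (weight-replicate 0 B)) (+-identityʳ D)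
pointWeight D (false ∷ B) B≢⊥ =
  let w , s , e = pointWeight D B (B≢⊥ ∘ cong (false ∷_)) in 0 ∷ w , s , e

block≢⊥ : ∀ {n} (f : BoolFun n) x {B} → IsBlock f x B → B ≢ ⊥
block≢⊥ f x block refl = block (cong f (⊕-identityʳ x))

≢⊥⇒0<∣∣ : ∀ {n} {B : Subset n} → B ≢ ⊥ → 0 < ∣ B ∣
≢⊥⇒0<∣∣ {B = []}        B≢⊥ = contradiction refl B≢⊥
≢⊥⇒0<∣∣ {B = true ∷ B}  B≢⊥ = z<s
≢⊥⇒0<∣∣ {B = false ∷ B} B≢⊥ = ≢⊥⇒0<∣∣ (B≢⊥ ∘ cong (false ∷_))

-- Flipping nothing changes no value, so every block contains some coordinate, and each coordinate
-- alone already carries `D`.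
trivialCover : ∀ {n} (f : BoolFun n) x D → Cover f x D (n * D)
trivialCover {n} f x D = replicate n D , ≤-reflexive (sum-replicate n D) , λ B block → begin
  D                         ≡⟨ *-identityʳ D ⟨
  D * 1                     ≤⟨ *-monoʳ-≤ D (≢⊥⇒0<∣∣ (block≢⊥ f x block)) ⟩
  D * ∣ B ∣                 ≡⟨ weight-replicate D B ⟨
  weight (replicate n D) B  ∎
  where open ≤-Reasoning

Separated : ∀ {n} → BoolFun n → ℕ → Set
Separated g d = ∀ y z → g y ≡ true → g z ≡ true → y ≢ z → d ≤ ∣ y ⊕ z ∣

-- At most one block has fewer than d/2 elements; it is covered by a single
-- coordinate, the others by the uniform weight.
separatedCover : ∀ {n d} (g : BoolFun n) → Separated g d →
  ∀ y → g y ≡ false → Cover g y d (n * 2 + d)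
separatedCover {n} {d} g separated y gy
  with anySubset? (λ B → isBlock? g y B ×-dec (2 * ∣ B ∣ <? d))
... | no noShort =
  replicate n 2 , ≤-trans (≤-reflexive (sum-replicate n 2)) (m≤m+n _ d) ,
  λ B block → subst (d ≤_) (sym (weight-replicate 2 B)) (≮⇒≥ λ short → noShort (B , block , short))
... | yes (S , blockS , short) with pointWeight d S (block≢⊥ g y blockS)
... | w , sum-w , weight-w =
  zipWith _+_ (replicate n 2) w ,
  ≤-reflexive (trans (sum-zipWith-+ (replicate n 2) w) (cong₂ _+_ (sum-replicate n 2) sum-w)) ,
  λ B block → subst (d ≤_) (sym (total B)) (heavy B block)
  where
  total : ∀ B → weight (zipWith _+_ (replicate n 2) w) B ≡ 2 * ∣ B ∣ + weight w B
  total B = trans (weight-zipWith-+ (replicate n 2) w B) (cong (_+ weight w B) (weight-replicate 2 B))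
  flips : ∀ {B} → IsBlock g y B → g (y ⊕ B) ≡ true
  flips block = Bool.¬-not (block ∘ (λ p → trans p (sym gy)))
  long : ∀ B → IsBlock g y B → B ≢ S → d ≤ 2 * ∣ B ∣
  -- From a 0-input both `B` and `S` lead to 1-inputs, whose distance ∣ B ⊕ S ∣ is at most ∣ B ∣ + ∣
  -- S ∣. Doubling this and using 2∣ S ∣ < d leaves d ≤ 2∣ B ∣.
  long B block B≢S = +-cancelˡ-≤ d _ _ (begin
    d + d                            ≤⟨ +-mono-≤ apart apart ⟩
    (∣ B ∣ + ∣ S ∣) + (∣ B ∣ + ∣ S ∣) ≡⟨ rearrange ∣ B ∣ ∣ S ∣ ⟩
    2 * ∣ S ∣ + 2 * ∣ B ∣            ≤⟨ +-monoˡ-≤ (2 * ∣ B ∣) (<⇒≤ short) ⟩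
    d + 2 * ∣ B ∣                    ∎)
    where
    open ≤-Reasoning
    rearrange : ∀ b s → (b + s) + (b + s) ≡ 2 * s + 2 * b
    rearrange = solve-∀
    apart : d ≤ ∣ B ∣ + ∣ S ∣
    apart = begin
      d                          ≤⟨ separated (y ⊕ B) (y ⊕ S) (flips block) (flips blockS) (B≢S ∘ ⊕-injectiveʳ y) ⟩
      ∣ (y ⊕ B) ⊕ (y ⊕ S) ∣      ≡⟨ cong ∣_∣ (⊕-translate y B S) ⟩
      ∣ B ⊕ S ∣                  ≤⟨ ∣⊕∣-≤ B S ⟩
      ∣ B ∣ + ∣ S ∣              ∎
  heavy : ∀ B → IsBlock g y B → d ≤ 2 * ∣ B ∣ + weight w B
  heavy B block with Vec.≡-dec Bool._≟_ B S
  ... | yes refl = ≤-trans (≤-reflexive (sym weight-w)) (m≤n+m _ (2 * ∣ B ∣))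
  ... | no  B≢S  = ≤-trans (long B block B≢S) (m≤m+n _ _)

-- Disjunctions

_∥_ : ∀ {m n} → BoolFun m → BoolFun n → BoolFun (m + n)
_∥_ {m} g h x = g (take m x) ∨ h (drop m x)

module _ {m n} (g : BoolFun m) (h : BoolFun n) (x : Input (m + n)) where

  ∥-⊕ : ∀ B → (g ∥ h) (x ⊕ B) ≡ g (take m x ⊕ take m B) ∨ h (drop m x ⊕ drop m B)
  ∥-⊕ B = cong₂ (λ u v → g u ∨ h v) (Vec.take-zipWith _xor_ x B) (Vec.drop-zipWith _xor_ x B)

  ∥-block : ∀ {B} → IsBlock (g ∥ h) x B →
    IsBlock g (take m x) (take m B) ⊎ IsBlock h (drop m x) (drop m B)
  ∥-block {B} block with isBlock? g (take m x) (take m B)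
  ... | yes blockˡ = inj₁ blockˡ
  ... | no ¬blockˡ = inj₂ λ eq →
    block (trans (∥-⊕ B) (cong₂ _∨_ (decidable-stable (_ Bool.≟ _) ¬blockˡ) eq))

  -- A block of the disjunction restricts to a block on at least one side, since otherwise neither
  -- disjunct changes. Concatenated weights therefore suffice, and their totals add.
  coverBoth : ∀ {D V W} → Cover g (take m x) D V → Cover h (drop m x) D W → Cover (g ∥ h) x D (V + W)
  coverBoth {D} (v , sum-v , v-covers) (w , sum-w , w-covers) =
    v ++ w , ≤-trans (≤-reflexive (Vec.sum-++ v)) (+-mono-≤ sum-v sum-w) ,
    λ B block → subst (D ≤_) (sym (weight-++ v w B)) (covers B (∥-block block))
    where
    covers : ∀ B → IsBlock g (take m x) (take m B) ⊎ IsBlock h (drop m x) (drop m B) →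
      D ≤ weight v (take m B) + weight w (drop m B)
    covers B (inj₁ block) = ≤-trans (v-covers _ block) (m≤m+n _ _)
    covers B (inj₂ block) = ≤-trans (w-covers _ block) (m≤n+m _ _)

  -- A true left disjunct keeps the disjunction true until it is flipped itself, so every block
  -- already contains a block of `g` and the right half needs no weight.
  coverˡ : ∀ {D V} → g (take m x) ≡ true → Cover g (take m x) D V → Cover (g ∥ h) x D V
  coverˡ {D} {V} gx (v , sum-v , v-covers) =
    v ++ replicate n 0 ,
    subst (_≤ V) (sym total) sum-v ,
    λ B block → subst (D ≤_) (sym (weight-++ v _ B)) (≤-trans (v-covers _ (left B block)) (m≤m+n _ _))
    where
    total : sum (v ++ replicate n 0) ≡ sum v
    total = trans (Vec.sum-++ v) (trans (cong (sum v +_) (sum-zeros n)) (+-identityʳ _))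
    left : ∀ B → IsBlock (g ∥ h) x B → IsBlock g (take m x) (take m B)
    left B block eq = block (trans (∥-⊕ B) (trans
      (cong (_∨ h (drop m x ⊕ drop m B)) (trans eq gx)) (sym (cong (_∨ h (drop m x)) gx))))

  coverʳ : ∀ {D W} → h (drop m x) ≡ true → Cover h (drop m x) D W → Cover (g ∥ h) x D W
  coverʳ {D} {W} hx (w , sum-w , w-covers) =
    replicate m 0 ++ w ,
    subst (_≤ W) (sym total) sum-w ,
    λ B block → subst (D ≤_) (sym (weight-++ (replicate m 0) w B))
      (≤-trans (w-covers _ (right B block)) (m≤n+m _ _))
    where
    total : sum (replicate m 0 ++ w) ≡ sum w
    total = trans (Vec.sum-++ (replicate m 0)) (cong (_+ sum w) (sum-zeros m))
    right : ∀ B → IsBlock (g ∥ h) x B → IsBlock h (drop m x) (drop m B)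
    right B block eq = block (trans (∥-⊕ B) (trans
      (cong (g (take m x ⊕ take m B) ∨_) (trans eq hx))
      (trans (Bool.∨-zeroʳ _) (sym (trans (cong (g (take m x) ∨_) hx) (Bool.∨-zeroʳ _))))))

orRows : ∀ {n} → BoolFun n → ∀ k → BoolFun (k * n)
orRows g zero    = λ _ → false
orRows g (suc k) = g ∥ orRows g k

-- Only the first row on which `g` is true receives weight, so the total does not depend on the
-- number of rows.
orRows-cover-true : ∀ {n} (g : BoolFun n) D k x → orRows g k x ≡ true → Cover (orRows g k) x D (n * D)
orRows-cover-true {n} g D (suc k) x fx with g (take n x) Bool.≟ true
... | yes gx  = coverˡ g (orRows g k) x gx (trivialCover g (take n x) D)
... | no gx≢ = coverʳ g (orRows g k) x hx (orRows-cover-true g D k (drop n x) hx)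
  where
  hx : orRows g k (drop n x) ≡ true
  hx = trans (sym (cong (_∨ orRows g k (drop n x)) (Bool.¬-not gx≢))) fx

-- At a 0-input every row is a 0-input of `g`, and each row pays for its own cover.
orRows-cover-false : ∀ {n D W} (g : BoolFun n) → (∀ y → g y ≡ false → Cover g y D W) →
  ∀ k x → orRows g k x ≡ false → Cover (orRows g k) x D (k * W)
orRows-cover-false g cover zero    x fx = [] , z≤n , λ B block → contradiction refl block
orRows-cover-false {n} g cover (suc k) x fx = coverBoth g (orRows g k) x
  (cover (take n x) (Bool.∨-conicalˡ _ _ fx))
  (orRows-cover-false g cover k (drop n x) (Bool.∨-conicalʳ _ _ fx))

-- Weak duality

disjoint-tail : ∀ {n} b c {A B : Subset n} → Disjoint (b ∷ A) (c ∷ B) → Disjoint A B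
disjoint-tail _ _ disjoint (i , i∈) = disjoint (suc i , there i∈)

remove : ∀ {n} → Vec ℕ n → Subset n → Vec ℕ n
remove = zipWith (λ a b → if b then 0 else a)

sum-remove : ∀ {n} (w : Vec ℕ n) B → weight w B + sum (remove w B) ≡ sum w
sum-remove []      []          = refl
sum-remove (a ∷ w) (true ∷ B)  = trans (+-assoc a _ _) (cong (a +_) (sum-remove w B))
sum-remove (a ∷ w) (false ∷ B) = trans (+-swap (weight w B) a _) (cong (a +_) (sum-remove w B))

weight-remove : ∀ {n} (w : Vec ℕ n) A B → Disjoint A B → weight (remove w A) B ≡ weight w B
weight-remove []      []          []          _ = refl
weight-remove (a ∷ w) (false ∷ A) (b ∷ B)     disjoint =
  cong ((if b then a else 0) +_) (weight-remove w A B (disjoint-tail false b disjoint))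
weight-remove (a ∷ w) (true ∷ A)  (false ∷ B) disjoint = weight-remove w A B (disjoint-tail true false disjoint)
weight-remove (a ∷ w) (true ∷ A)  (true ∷ B)  disjoint = contradiction (zero , here) disjoint

-- Each block uses up at least `D` of the total weight. Erasing the weights on one block leaves the
-- blocks disjoint from it as heavy as before, so the induction continues with what is left.
packing≤cover : ∀ {n D} (w : Vec ℕ n) Bs → All (λ B → D ≤ weight w B) Bs → AllPairs Disjoint Bs →
  length Bs * D ≤ sum w
packing≤cover w []       _                _                     = z≤n
packing≤cover {D = D} w (A ∷ Bs) (heavy ∷ heavies) (disjoint ∷ disjoints) = begin
  D + length Bs * D              ≤⟨ +-mono-≤ heavy (packing≤cover (remove w A) Bs heavies′ disjoints) ⟩
  weight w A + sum (remove w A)  ≡⟨ sum-remove w A ⟩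
  sum w                          ∎
  where
  open ≤-Reasoning
  heavies′ : All (λ B → D ≤ weight (remove w A) B) Bs
  heavies′ = All.zipWith (λ {B} (dis , h) → subst (D ≤_) (sym (weight-remove w A B dis)) h) (disjoint , heavies)

-- The embedding of ℕ in ℚ

toℚᵘ-toℚ : ∀ k → ℚ.toℚᵘ (toℚ k) ℚᵘ.≃ ℚᵘ.mkℚᵘ (ℤ.+ k) 0
toℚᵘ-toℚ k = ℚ.toℚᵘ-fromℚᵘ (ℚᵘ.mkℚᵘ (ℤ.+ k) 0)

-- `toℚ` normalises by a gcd, which is stuck on variables; the identity is therefore checked on
-- unnormalised fractions with denominator 1.
toℚ-+ : ∀ a b → toℚ (a + b) ≡ toℚ a ℚ.+ toℚ b
toℚ-+ a b = ℚ.toℚᵘ-injective (begin-equality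
  ℚ.toℚᵘ (toℚ (a + b))                     ≃⟨ toℚᵘ-toℚ (a + b) ⟩
  ℚᵘ.mkℚᵘ (ℤ.+ (a + b)) 0                    ≃⟨ ℚᵘ.*≡* (cong (ℤ._* ℤ.+ 1) numerator) ⟩
  ℚᵘ.mkℚᵘ (ℤ.+ a) 0 ℚᵘ.+ ℚᵘ.mkℚᵘ (ℤ.+ b) 0     ≃⟨ ℚᵘ.+-cong (toℚᵘ-toℚ a) (toℚᵘ-toℚ b) ⟨
  ℚ.toℚᵘ (toℚ a) ℚᵘ.+ ℚ.toℚᵘ (toℚ b)       ≃⟨ ℚ.toℚᵘ-homo-+ (toℚ a) (toℚ b) ⟨
  ℚ.toℚᵘ (toℚ a ℚ.+ toℚ b)                 ∎)
  where
  open ℚᵘ.≤-Reasoning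
  numerator : ℤ.+ (a + b) ≡ ℤ.+ a ℤ.* ℤ.+ 1 ℤ.+ ℤ.+ b ℤ.* ℤ.+ 1
  numerator = trans (ℤ.pos-+ a b) (sym (cong₂ ℤ._+_ (ℤ.*-identityʳ (ℤ.+ a)) (ℤ.*-identityʳ (ℤ.+ b))))

toℚ-* : ∀ a b → toℚ (a * b) ≡ toℚ a ℚ.* toℚ b
toℚ-* zero    b = sym (ℚ.*-zeroˡ (toℚ b))
toℚ-* (suc a) b = begin
  toℚ (b + a * b)                      ≡⟨ toℚ-+ b (a * b) ⟩
  toℚ b ℚ.+ toℚ (a * b)                ≡⟨ cong₂ ℚ._+_ (sym (ℚ.*-identityˡ (toℚ b))) (toℚ-* a b) ⟩
  1ℚ ℚ.* toℚ b ℚ.+ toℚ a ℚ.* toℚ b     ≡⟨ ℚ.*-distribʳ-+ (toℚ b) 1ℚ (toℚ a) ⟨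
  (1ℚ ℚ.+ toℚ a) ℚ.* toℚ b             ≡⟨ cong (ℚ._* toℚ b) (toℚ-+ 1 a) ⟨
  toℚ (suc a) ℚ.* toℚ b                ∎
  where open ≡-Reasoning

0≤toℚ : ∀ k → 0ℚ ℚ.≤ toℚ k
0≤toℚ k = ℚ.nonNegative⁻¹ (toℚ k) {{ℚ.normalize-nonNeg k 1}}

toℚ-mono-≤ : ∀ {a b} → a ≤ b → toℚ a ℚ.≤ toℚ b
toℚ-mono-≤ {a} {b} a≤b = begin
  toℚ a                          ≡⟨ ℚ.+-identityʳ (toℚ a) ⟨
  toℚ a ℚ.+ 0ℚ                   ≤⟨ ℚ.+-monoʳ-≤ (toℚ a) (0≤toℚ (b ℕ.∸ a)) ⟩
  toℚ a ℚ.+ toℚ (b ℕ.∸ a)        ≡⟨ toℚ-+ a (b ℕ.∸ a) ⟨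
  toℚ (a + (b ℕ.∸ a))            ≡⟨ cong toℚ (m+[n∸m]≡n a≤b) ⟩
  toℚ b                          ∎
  where open ℚ.≤-Reasoning

-- Weak duality for fractional packings

weightedSum : ∀ {n} → Vec ℕ n → (Fin n → ℚ) → ℚ
weightedSum []      q = 0ℚ
weightedSum (a ∷ w) q = toℚ a ℚ.* q zero ℚ.+ weightedSum w (q ∘ suc)

weightedSum-0 : ∀ {n} (w : Vec ℕ n) → weightedSum w (λ _ → 0ℚ) ≡ 0ℚ
weightedSum-0 []      = refl
weightedSum-0 (a ∷ w) = cong₂ ℚ._+_ (ℚ.*-zeroʳ (toℚ a)) (weightedSum-0 w)

weightedSum-+ : ∀ {n} (w : Vec ℕ n) p q →
  weightedSum w (λ i → p i ℚ.+ q i) ≡ weightedSum w p ℚ.+ weightedSum w q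
weightedSum-+ []      p q = refl
weightedSum-+ (a ∷ w) p q = trans
  (cong₂ ℚ._+_ (ℚ.*-distribˡ-+ (toℚ a) (p zero) (q zero)) (weightedSum-+ w (p ∘ suc) (q ∘ suc)))
  (interchange (toℚ a ℚ.* p zero) (toℚ a ℚ.* q zero) (weightedSum w (p ∘ suc)) (weightedSum w (q ∘ suc)))
  where
  open CommutativeSemigroupProperties (CommutativeRing.+-commutativeSemigroup ℚ.+-*-commutativeRing)
    using (interchange)

weightedSum≤sum : ∀ {n} (w : Vec ℕ n) q → (∀ i → q i ℚ.≤ 1ℚ) → weightedSum w q ℚ.≤ toℚ (sum w)
weightedSum≤sum []      q q≤1 = ℚ.≤-refl
weightedSum≤sum (a ∷ w) q q≤1 = begin
  toℚ a ℚ.* q zero ℚ.+ weightedSum w (q ∘ suc)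
    ≤⟨ ℚ.+-mono-≤ (ℚ.*-monoˡ-≤-nonNeg (toℚ a) {{ℚ.normalize-nonNeg a 1}} (q≤1 zero)) (weightedSum≤sum w (q ∘ suc) (q≤1 ∘ suc)) ⟩
  toℚ a ℚ.* 1ℚ ℚ.+ toℚ (sum w)  ≡⟨ cong (ℚ._+ toℚ (sum w)) (ℚ.*-identityʳ (toℚ a)) ⟩
  toℚ a ℚ.+ toℚ (sum w)         ≡⟨ toℚ-+ a (sum w) ⟨
  toℚ (a + sum w)               ∎
  where open ℚ.≤-Reasoning

-- The contribution of a single block: mass `p` on `B` loads exactly the coordinates in `B`.
weightedSum-indicator : ∀ {n} (w : Vec ℕ n) B p →
  weightedSum w (λ i → if i ∈ᵇ B then p else 0ℚ) ≡ toℚ (weight w B) ℚ.* p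
weightedSum-indicator []      []          p = sym (ℚ.*-zeroˡ p)
weightedSum-indicator (a ∷ w) (true ∷ B)  p = begin
  toℚ a ℚ.* p ℚ.+ weightedSum w (λ i → if i ∈ᵇ B then p else 0ℚ)
    ≡⟨ cong (toℚ a ℚ.* p ℚ.+_) (weightedSum-indicator w B p) ⟩
  toℚ a ℚ.* p ℚ.+ toℚ (weight w B) ℚ.* p  ≡⟨ ℚ.*-distribʳ-+ p (toℚ a) (toℚ (weight w B)) ⟨
  (toℚ a ℚ.+ toℚ (weight w B)) ℚ.* p      ≡⟨ cong (ℚ._* p) (toℚ-+ a (weight w B)) ⟨
  toℚ (a + weight w B) ℚ.* p              ∎
  where open ≡-Reasoning
weightedSum-indicator (a ∷ w) (false ∷ B) p = trans
  (cong₂ ℚ._+_ (ℚ.*-zeroʳ (toℚ a)) (weightedSum-indicator w B p)) (ℚ.+-identityˡ _)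

module _ {n} (f : BoolFun n) (x : Input n) (p : Subset n → ℚ) {D W : ℕ} where

  private
    term : (Subset n → Bool) → Subset n → ℚ
    term P B = if does (isBlock? f x B) then (if P B then p B else 0ℚ) else 0ℚ

  -- Double counting: D ∑ p(B) ≤ ∑ p(B) w(B) = ∑ᵢ wᵢ ∑ p(B) over B ∋ i, which is at most ∑ᵢ wᵢ by
  -- capacity. The exchange of sums is an induction over the list of subsets.
  weakDuality : FracPacking f x p → Cover f x D W → toℚ D ℚ.* packValue f x p ℚ.≤ toℚ W
  weakDuality (0≤p , capacity) (w , sum-w , w-covers) = begin
    toℚ D ℚ.* packValue f x p                          ≤⟨ termwise (allSubsets n) ⟩
    weightedSum w (λ i → blockSum f x (i ∈ᵇ_) p)       ≤⟨ weightedSum≤sum w _ capacity ⟩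
    toℚ (sum w)                                        ≤⟨ toℚ-mono-≤ sum-w ⟩
    toℚ W                                              ∎
    where
    open ℚ.≤-Reasoning
    -- The decision is an argument so that matching on it reduces the conditionals on both sides at
    -- once.
    pointwise : ∀ B (block? : Dec (IsBlock f x B)) →
      toℚ D ℚ.* (if does block? then p B else 0ℚ) ℚ.≤
      weightedSum w (λ i → if does block? then (if i ∈ᵇ B then p B else 0ℚ) else 0ℚ)
    pointwise B (no _)      = ℚ.≤-reflexive (trans (ℚ.*-zeroʳ (toℚ D)) (sym (weightedSum-0 w)))
    pointwise B (yes block) = ℚ.≤-trans
      (ℚ.*-monoʳ-≤-nonNeg (p B) {{ℚ.nonNegative (0≤p B)}} (toℚ-mono-≤ (w-covers B block)))
      (ℚ.≤-reflexive (sym (weightedSum-indicator w B (p B))))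
    termwise : ∀ Bs → toℚ D ℚ.* sumℚ (term (λ _ → true)) Bs ℚ.≤
      weightedSum w (λ i → sumℚ (term (i ∈ᵇ_)) Bs)
    termwise []       = ℚ.≤-reflexive (trans (ℚ.*-zeroʳ (toℚ D)) (sym (weightedSum-0 w)))
    termwise (B ∷ Bs) = begin
      toℚ D ℚ.* (term _ B ℚ.+ sumℚ (term _) Bs)
        ≡⟨ ℚ.*-distribˡ-+ (toℚ D) (term _ B) (sumℚ (term _) Bs) ⟩
      toℚ D ℚ.* term _ B ℚ.+ toℚ D ℚ.* sumℚ (term _) Bs
        ≤⟨ ℚ.+-mono-≤ (pointwise B (isBlock? f x B)) (termwise Bs) ⟩
      weightedSum w (λ i → term (i ∈ᵇ_) B) ℚ.+ weightedSum w (λ i → sumℚ (term (i ∈ᵇ_)) Bs)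
        ≡⟨ weightedSum-+ w _ _ ⟨
      weightedSum w (λ i → term (i ∈ᵇ_) B ℚ.+ sumℚ (term (i ∈ᵇ_)) Bs) ∎

bs≤ : ∀ {n} (f : BoolFun n) D R .{{_ : ℕ.NonZero D}} → (∀ x → Cover f x D (R * D)) → BsAtMost f (toℚ R)
bs≤ f D R cover x Bs blocks disjoint =
  let w , sum-w , w-covers = cover x in
  toℚ-mono-≤ (*-cancelʳ-≤ (length Bs) R D
    (≤-trans (packing≤cover w Bs (All.map (w-covers _) blocks) disjoint) sum-w))

bs*≤ : ∀ {n} (f : BoolFun n) D R .{{_ : ℕ.NonZero D}} → (∀ x → Cover f x D (R * D)) → BsStarAtMost f (toℚ R)
bs*≤ f D R cover x p packing = ℚ.*-cancelˡ-≤-pos (toℚ D) {{ℚ.normalize-pos D 1}} (begin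
  toℚ D ℚ.* packValue f x p  ≤⟨ weakDuality f x p packing (cover x) ⟩
  toℚ (R * D)                ≡⟨ trans (cong toℚ (*-comm R D)) (toℚ-* D R) ⟩
  toℚ D ℚ.* toℚ R            ∎)
  where open ℚ.≤-Reasoning

-- Certificates

-- The bound of `CAtLeast` at a fixed input and over ℕ, so that bounds for separate rows can be
-- added.
HittingSetsAtLeast : ∀ {n} → BoolFun n → Input n → ℕ → Set
HittingSetsAtLeast f x r = ∀ S → HittingSet f x S → r ≤ ∣ S ∣

∣++∣ : ∀ {m n} (A : Subset m) (B : Subset n) → ∣ A ++ B ∣ ≡ ∣ A ∣ + ∣ B ∣
∣++∣ []          B = refl
∣++∣ (true ∷ A)  B = cong suc (∣++∣ A B)
∣++∣ (false ∷ A) B = ∣++∣ A B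

nonempty-++⊥ : ∀ {m n} (S A : Subset m) (T : Subset n) → Nonempty ((S ++ T) ∩ (A ++ ⊥)) → Nonempty (S ∩ A)
nonempty-++⊥ []      []      T (i , i∈) rewrite ∩-zeroʳ T = contradiction i∈ ∉⊥
nonempty-++⊥ (true ∷ S) (true ∷ A) T (zero , here) = zero , here
nonempty-++⊥ (_ ∷ S) (_ ∷ A) T (suc i , there i∈) =
  let j , j∈ = nonempty-++⊥ S A T (i , i∈) in suc j , there j∈

nonempty-⊥++ : ∀ {m n} (S : Subset m) (T B : Subset n) → Nonempty ((S ++ T) ∩ (⊥ ++ B)) → Nonempty (T ∩ B)
nonempty-⊥++ []          T B ne                 = ne
nonempty-⊥++ (false ∷ S) T B (suc i , there i∈) = nonempty-⊥++ S T B (i , i∈)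
nonempty-⊥++ (true ∷ S)  T B (suc i , there i∈) = nonempty-⊥++ S T B (i , i∈)

take-++ : ∀ {A : Set} {m n} (u : Vec A m) (v : Vec A n) → take m (u ++ v) ≡ u
take-++ []      v = refl
take-++ (a ∷ u) v = cong (a ∷_) (take-++ u v)

drop-++ : ∀ {A : Set} {m n} (u : Vec A m) (v : Vec A n) → drop m (u ++ v) ≡ v
drop-++ []      v = refl
drop-++ (a ∷ u) v = drop-++ u v

∥-++ : ∀ {m n} (g : BoolFun m) (h : BoolFun n) y z → (g ∥ h) (y ++ z) ≡ g y ∨ h z
∥-++ g h y z = cong₂ (λ u v → g u ∨ h v) (take-++ y z) (drop-++ y z)

-- A block of one half, padded with `⊥`, is a block of the disjunction because the other half stays
-- false. Hence each half of a hitting set hits all blocks of its own function.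
∥-hitting : ∀ {m n} (g : BoolFun m) (h : BoolFun n) y z {r s} → g y ≡ false → h z ≡ false →
  HittingSetsAtLeast g y r → HittingSetsAtLeast h z s → HittingSetsAtLeast (g ∥ h) (y ++ z) (r + s)
∥-hitting {m} g h y z {r} {s} gy hz g-hard h-hard U hits with Vec.splitAt m U
... | S , T , refl = subst (r + s ≤_) (sym (∣++∣ S T)) (+-mono-≤ (g-hard S S-hits) (h-hard T T-hits))
  where
  open ≡-Reasoning
  flip : ∀ A B → (g ∥ h) ((y ++ z) ⊕ (A ++ B)) ≡ g (y ⊕ A) ∨ h (z ⊕ B)
  flip A B = trans (cong (g ∥ h) (Vec.zipWith-++ _xor_ y z A B)) (∥-++ g h (y ⊕ A) (z ⊕ B))
  S-hits : HittingSet g y S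
  S-hits A block = nonempty-++⊥ S A T (hits (A ++ ⊥) (λ eq → block (begin
    g (y ⊕ A)                        ≡⟨ Bool.∨-identityʳ _ ⟨
    g (y ⊕ A) ∨ false                ≡⟨ cong (g (y ⊕ A) ∨_) (trans (cong h (⊕-identityʳ z)) hz) ⟨
    g (y ⊕ A) ∨ h (z ⊕ ⊥)            ≡⟨ flip A ⊥ ⟨
    (g ∥ h) ((y ++ z) ⊕ (A ++ ⊥))    ≡⟨ eq ⟩
    (g ∥ h) (y ++ z)                 ≡⟨ ∥-++ g h y z ⟩
    g y ∨ h z                        ≡⟨ cong (g y ∨_) hz ⟩
    g y ∨ false                      ≡⟨ Bool.∨-identityʳ _ ⟩
    g y                              ∎)))
  T-hits : HittingSet h z T
  T-hits B block = nonempty-⊥++ S T B (hits (⊥ ++ B) (λ eq → block (begin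
    h (z ⊕ B)                        ≡⟨ cong (_∨ h (z ⊕ B)) (trans (cong g (⊕-identityʳ y)) gy) ⟨
    g (y ⊕ ⊥) ∨ h (z ⊕ B)            ≡⟨ flip ⊥ B ⟨
    (g ∥ h) ((y ++ z) ⊕ (⊥ ++ B))    ≡⟨ eq ⟩
    (g ∥ h) (y ++ z)                 ≡⟨ ∥-++ g h y z ⟩
    g y ∨ h z                        ≡⟨ cong (_∨ h z) gy ⟩
    h z                              ∎)))

repeatRow : ∀ {n} k → Input n → Input (k * n)
repeatRow zero    y = []
repeatRow (suc k) y = y ++ repeatRow k y

orRows-repeat : ∀ {n} (g : BoolFun n) {y} → g y ≡ false → ∀ k → orRows g k (repeatRow k y) ≡ false
orRows-repeat g gy zero    = refl
orRows-repeat g {y} gy (suc k) =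
  trans (∥-++ g (orRows g k) y (repeatRow k y)) (cong₂ _∨_ gy (orRows-repeat g gy k))

orRows-hitting : ∀ {n} (g : BoolFun n) {y r} → g y ≡ false → HittingSetsAtLeast g y r →
  ∀ k → HittingSetsAtLeast (orRows g k) (repeatRow k y) (k * r)
orRows-hitting g gy hard zero    _ _ = z≤n
orRows-hitting g {y} gy hard (suc k) =
  ∥-hitting g (orRows g k) y (repeatRow k y) gy (orRows-repeat g gy k) hard (orRows-hitting g gy hard k)

-- The indicator of the nonzero codewords

-- The length ∣ S ∣ in the type records that there are only 2 ^ ∣ S ∣ patterns on `S`, the count
-- that `collision` needs.
restrict : ∀ {n} (S : Subset n) → Vec Bool n → Vec Bool ∣ S ∣
restrict []          []      = []
restrict (true ∷ S)  (b ∷ x) = b ∷ restrict S x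
restrict (false ∷ S) (b ∷ x) = restrict S x

restrict-≡⇒∩-empty : ∀ {n} (S : Subset n) x y → restrict S x ≡ restrict S y → Empty (S ∩ (x ⊕ y))
restrict-≡⇒∩-empty (true ∷ S)  (false ∷ x) (true ∷ y)  ()
restrict-≡⇒∩-empty (true ∷ S)  (true ∷ x)  (false ∷ y) ()
restrict-≡⇒∩-empty (true ∷ S)  (true ∷ x)  (true ∷ y)  eq (suc i , there i∈) =
  restrict-≡⇒∩-empty S x y (Vec.∷-injectiveʳ eq) (i , i∈)
restrict-≡⇒∩-empty (true ∷ S)  (false ∷ x) (false ∷ y) eq (suc i , there i∈) =
  restrict-≡⇒∩-empty S x y (Vec.∷-injectiveʳ eq) (i , i∈)
restrict-≡⇒∩-empty (false ∷ S) (_ ∷ x)     (_ ∷ y)     eq (suc i , there i∈) =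
  restrict-≡⇒∩-empty S x y eq (i , i∈)

module _ {k n d} (code : LinearCode k n d) where
  open LinearCode code

  nonzeroCodeword? : ∀ y → Dec (∃ λ a → a ≢ ⊥ × encode a ≡ y)
  nonzeroCodeword? y =
    anySubset? (λ a → ¬? (Vec.≡-dec Bool._≟_ a ⊥) ×-dec Vec.≡-dec Bool._≟_ (encode a) y)

  nonzeroCodeword : BoolFun n
  nonzeroCodeword y = does (nonzeroCodeword? y)

  codeword : ∀ y → nonzeroCodeword y ≡ true → ∃ λ a → a ≢ ⊥ × encode a ≡ y
  codeword y eq with nonzeroCodeword? y
  ... | yes found = found

  -- By linearity the difference of two codewords encodes the difference of their messages, which is
  -- nonzero when the codewords differ.
  separated : Separated nonzeroCodeword d
  separated y z gy gz y≢z with codeword y gy | codeword z gz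
  ... | a , _ , refl | b , _ , refl = subst (λ v → d ≤ ∣ v ∣) (encode-⊕ a b)
    (distance (a ⊕ b) (y≢z ∘ cong encode ∘ ⊕≡⊥⇒≡ a b))

  -- Positive distance keeps the encoding of a nonzero message away from zero.
  nonzeroCodeword-⊥ : 0 < d → nonzeroCodeword ⊥ ≡ false
  nonzeroCodeword-⊥ 0<d = dec-false (nonzeroCodeword? ⊥) λ (a , a≢⊥ , eq) →
    <⇒≱ 0<d (≤-trans (distance a a≢⊥) (≤-reflexive (trans (cong ∣_∣ eq) (∣⊥∣≡0 n))))

  -- A set of fewer than k coordinates cannot tell all 2ᵏ messages apart, and the
  -- difference of two confused codewords is a block at ⊥ that it misses.
  nonzeroCodeword-hitting : 0 < d → HittingSetsAtLeast nonzeroCodeword ⊥ k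
  nonzeroCodeword-hitting 0<d S hits = ≮⇒≥ λ ∣S∣<k →
    let a , b , a≢b , eq = collision (^-monoʳ-< 2 (n<1+n 1) ∣S∣<k) (toIndex ∘ restrict S ∘ encode)
        missed = restrict-≡⇒∩-empty S (encode a) (encode b) (toIndex-injective _ _ eq)
        isCodeword = dec-true (nonzeroCodeword? _)
          (a ⊕ b , a≢b ∘ ⊕≡⊥⇒≡ a b , trans (encode-⊕ a b) (sym (⊕-identityˡ _)))
    in missed (hits (encode a ⊕ encode b) λ same →
         contradiction (trans (sym isCodeword) (trans same (nonzeroCodeword-⊥ 0<d))) λ ())

-- Choice of parameters

cover-enlarge : ∀ {n D V W} (f : BoolFun n) x → V ≤ W → Cover f x D V → Cover f x D W
cover-enlarge f x V≤W (w , sum-w , w-covers) = w , ≤-trans sum-w V≤W , w-covers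

-- The constant 19 is 2 · 9 + 1: the n rows of a 0-input cost 2n + m each, and 2n ≤ 18m. A 1-input
-- costs only n m.
orRows-cover : ∀ {n m} (g : BoolFun n) → Separated g m → n ≤ 9 * m →
  ∀ x → Cover (orRows g n) x m (19 * n * m)
orRows-cover {n} {m} g g-separated n≤9m x with orRows g n x Bool.≟ true
... | yes fx = cover-enlarge (orRows g n) x (*-monoˡ-≤ m (m≤m+n n _)) (orRows-cover-true g m n x fx)
... | no fx≢ = cover-enlarge (orRows g n) x total
  (orRows-cover-false g (separatedCover g g-separated) n x (Bool.¬-not fx≢))
  where
  open ≤-Reasoning
  collect : ∀ n m → n * (9 * m * 2 + m) ≡ 19 * n * m
  collect = solve-∀
  total : n * (n * 2 + m) ≤ 19 * n * m
  total = begin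
    n * (n * 2 + m)        ≤⟨ *-monoʳ-≤ n (+-monoˡ-≤ m (*-monoˡ-≤ 2 n≤9m)) ⟩
    n * (9 * m * 2 + m)    ≡⟨ collect n m ⟩
    19 * n * m             ∎

ninth : ℚ
ninth = ℤ.+ 1 ℚ./ 9

ninth-≤ : ∀ a s → a ≤ 9 * s → ninth ℚ.* toℚ a ℚ.≤ toℚ s
ninth-≤ a s a≤9s = begin
  ninth ℚ.* toℚ a                ≤⟨ ℚ.*-monoˡ-≤-nonNeg ninth (toℚ-mono-≤ a≤9s) ⟩
  ninth ℚ.* toℚ (9 * s)          ≡⟨ cong (ninth ℚ.*_) (toℚ-* 9 s) ⟩
  ninth ℚ.* (toℚ 9 ℚ.* toℚ s)    ≡⟨ ℚ.*-assoc ninth (toℚ 9) (toℚ s) ⟨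
  -- The closed product `ninth ℚ.* toℚ 9` evaluates to `1ℚ`.
  ninth ℚ.* toℚ 9 ℚ.* toℚ s      ≡⟨ ℚ.*-identityˡ (toℚ s) ⟩
  toℚ s                          ∎
  where open ℚ.≤-Reasoning

-- The distance of the code controls the block measures and its dimension controls the certificates;
-- both equal `m`, which is at least n/9.
separation : ∀ {n m} → LinearCode m n m → 0 < m → n ≤ 9 * m →
  Σ (BoolFun (n * n)) λ f →
  BsAtMost f (toℚ 19 ℚ.* toℚ n) × BsStarAtMost f (toℚ 19 ℚ.* toℚ n) ×
  CAtLeast f (ninth ℚ.* toℚ (n * n))
separation {n} {m} code 0<m n≤9m =
  f ,
  subst (BsAtMost f) (toℚ-* 19 n) (bs≤ f m (19 * n) cover) ,
  subst (BsStarAtMost f) (toℚ-* 19 n) (bs*≤ f m (19 * n) cover) ,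
  -- Certificates are large at the all-zero input.
  repeatRow n ⊥ , λ S hits → ninth-≤ (n * n) ∣ S ∣ (begin
    n * n          ≤⟨ *-monoʳ-≤ n n≤9m ⟩
    n * (9 * m)    ≡⟨ swap n m ⟩
    9 * (n * m)    ≤⟨ *-monoʳ-≤ 9 (hard S hits) ⟩
    9 * ∣ S ∣      ∎)
  where
  open ≤-Reasoning
  instance
    m≢0 : ℕ.NonZero m
    m≢0 = ℕ.>-nonZero 0<m
  g : BoolFun n
  g = nonzeroCodeword code
  f : BoolFun (n * n)
  f = orRows g n
  cover : ∀ x → Cover f x m (19 * n * m)
  cover = orRows-cover g (separated code) n≤9m
  hard : HittingSetsAtLeast f (repeatRow n ⊥) (n * m)
  hard = orRows-hitting g (nonzeroCodeword-⊥ code 0<m) (nonzeroCodeword-hitting code 0<m) n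
  swap : ∀ n m → n * (9 * m) ≡ 9 * (n * m)
  swap = solve-∀

-- The remainder is at most 4, and 4 ≤ 4⌊n/5⌋ because the quotient is positive.
n≤9[n/5] : ∀ n → 5 ≤ n → n ≤ 9 * (n / 5)
n≤9[n/5] n 5≤n = begin
  n                          ≡⟨ m≡m%n+[m/n]*n n 5 ⟩
  n % 5 + n / 5 * 5          ≤⟨ +-monoˡ-≤ (n / 5 * 5) (ℕ.s≤s⁻¹ (m%n<n n 5)) ⟩
  4 + n / 5 * 5              ≤⟨ +-monoˡ-≤ (n / 5 * 5) (*-monoʳ-≤ 4 (m≥n⇒m/n>0 5≤n)) ⟩
  4 * (n / 5) + n / 5 * 5    ≡⟨ collect (n / 5) ⟩
  9 * (n / 5)                ∎
  where
  open ≤-Reasoning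
  collect : ∀ m → 4 * m + m * 5 ≡ 9 * m
  collect = solve-∀

mainTheorem4 : Σ ℚ λ c → Σ ℚ λ c′ → Positive c × Positive c′ ×
    ∃ λ n₀ → ∀ (n : ℕ) → n₀ ℕ.≤ n →
    Σ (BoolFun (n * n)) λ f →
    BsAtMost f (c ℚ.* toℚ n) × BsStarAtMost f (c ℚ.* toℚ n) ×
    CAtLeast f (c′ ℚ.* toℚ (n * n))
-- n₀ = 5 is the least value from which ⌊n/5⌋ is positive.
mainTheorem4 = toℚ 19 , ninth , _ , _ , 5 , λ n 5≤n →
  let 0<m = m≥n⇒m/n>0 5≤n
      5m≤n = ≤-trans (≤-reflexive (*-comm 5 (n / 5))) (m/n*n≤m n 5)
  in separation (goodCode (n / 5) n {{ℕ.>-nonZero 0<m}} 5m≤n) 0<m (n≤9[n/5] n 5≤n)
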